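{- Let $\Omega=\{u\in\mathbb{Q}^{\omega_1}: 0\leq u_\alpha\leq 1\text{ for all }\alpha<\omega_1,\text{ and }u_\gamma\leq 2u_\beta\text{ whenever }0<\gamma<\beta<\omega_1\}$, and let $G$ be the $\mathbb{Q}$-vector sublattice of $\mathbb{Q}^{\Omega}$ (with pointwise operations) generated by the projections $p_\alpha\colon\Omega\to\mathbb{Q}$, $u\mapsto u_\alpha$ ($\alpha<\omega_1$), together with the constant function $p_{\omega_1}\colon u\mapsto 1$. Then $G$ is Archimedean with strong unit. Furthermore, no deviation on the lattice $\operatorname{Id}_c G$ of principal $\ell$-ideals of $G$ is either left isotone or right antitone. In fact, for every deviation $\smallsetminus$ on $\operatorname{Id}_c G$ there are ordinals $\alpha,\beta,\alpha',\beta'$ with $0<\alpha<\beta<\omega_1$ and $0<\alpha'<\beta'<\omega_1$ such that $\langle p_0\rangle\smallsetminus\langle p_\beta\rangle\not\leq\langle p_0\rangle\smallsetminus\langle p_\alpha\rangle$ and $\langle p_{\alpha'}\rangle\smallsetminus\langle p_0\rangle\not\leq\langle p_{\beta'}\rangle\smallsetminus\langle p_0\rangle$.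
   Context: For $a\in G$, $\langle a\rangle=\{x\in G: -n|a|\leq x\leq n|a|\text{ for some }n\in\omega\}$ with $|a|=a\vee(-a)$; $\operatorname{Id}_c G$ is the set of all such $\langle a\rangle$, ordered by inclusion (a distributive lattice with $0$). A deviation on a distributive lattice $D$ with $0$ is a binary operation $\smallsetminus$ with $x\leq y\vee(x\smallsetminus y)$ and $(x\smallsetminus y)\wedge(y\smallsetminus x)=0$ for all $x,y$. It is left isotone if $x\leq x'$ implies $x\smallsetminus y\leq x'\smallsetminus y$, and right antitone if $y\leq y'$ implies $x\smallsetminus y'\leq x\smallsetminus y$. -}

module Defs where

open import Data.Nat as ℕ using (ℕ)
open import Data.Integer as ℤ using (ℤ)
open import Data.Rational as ℚ using (ℚ; 0ℚ; 1ℚ; _≤_; _<_; _+_; _*_; -_; _⊔_; _⊓_)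
open import Data.Product using (Σ; _×_; _,_; ∃; ∃-syntax; proj₁)
open import Data.Sum using (_⊎_)
open import Relation.Binary.PropositionalEquality using (_≡_)
open import Relation.Binary.Structures using (IsStrictTotalOrder)
open import Induction.WellFounded using (WellFounded)
open import Relation.Nullary using (¬_)

-- ω₁, axiomatised up to order-isomorphism (classically):
-- a well-founded strict total order whose proper initial segments are
-- all countable, but which is itself uncountable.  `zero` is its least
-- element (the ordinal 0).

record Omega1 : Set₁ where
  field
    I      : Set
    _≺_    : I → I → Set
    isSTO  : IsStrictTotalOrder _≡_ _≺_
    wf     : WellFounded _≺_
    zero   : I
    least  : ∀ x → ¬ (x ≺ zero)
    segCountable : ∀ β → Σ (I → ℕ) λ f →
                     ∀ γ γ' → γ ≺ β → γ' ≺ β → f γ ≡ f γ' → γ ≡ γ'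
    uncountable  : ¬ (Σ (I → ℕ) λ f → ∀ γ γ' → f γ ≡ f γ' → γ ≡ γ')

module Construction (W : Omega1) where
  open Omega1 W

  two : ℚ
  two = 1ℚ + 1ℚ

  nℚ : ℕ → ℚ
  nℚ n = ℤ.+ n ℚ./ 1

  Ω : Set
  Ω = Σ (I → ℚ) λ u →
        (∀ α → (0ℚ ≤ u α) × (u α ≤ 1ℚ)) ×
        (∀ γ β → zero ≺ γ → γ ≺ β → u γ ≤ two * u β)

  -- Terms generating the ℚ-vector sublattice of ℚ^Ω generated by the
  -- projections p_α and the constant p_{ω₁} = 1.
  data Term : Set where
    p    : I → Term
    pω₁  : Term
    𝟘    : Term
    _⊕_  : Term → Term → Term
    _·_  : ℚ → Term → Term
    _∨_  : Term → Term → Term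
    _∧_  : Term → Term → Term

  -- evaluation: elements of G are the functions Ω → ℚ denoted by terms
  ⟦_⟧ : Term → Ω → ℚ
  ⟦ p α ⟧   u = proj₁ u α
  ⟦ pω₁ ⟧   u = 1ℚ
  ⟦ 𝟘 ⟧     u = 0ℚ
  ⟦ a ⊕ b ⟧ u = ⟦ a ⟧ u + ⟦ b ⟧ u
  ⟦ q · a ⟧ u = q * ⟦ a ⟧ u
  ⟦ a ∨ b ⟧ u = ⟦ a ⟧ u ⊔ ⟦ b ⟧ u
  ⟦ a ∧ b ⟧ u = ⟦ a ⟧ u ⊓ ⟦ b ⟧ u

  _≤G_ : Term → Term → Set
  a ≤G b = ∀ u → ⟦ a ⟧ u ≤ ⟦ b ⟧ u

  _≈G_ : Term → Term → Set
  a ≈G b = ∀ u → ⟦ a ⟧ u ≡ ⟦ b ⟧ u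

  ∣_∣ : Term → Term
  ∣ a ∣ = a ∨ ((- 1ℚ) · a)

  _∈⟨_⟩ : Term → Term → Set
  x ∈⟨ a ⟩ = ∃[ n ] (((- nℚ n) · ∣ a ∣) ≤G x × x ≤G (nℚ n · ∣ a ∣))

  -- order of Id_c G: inclusion of principal ℓ-ideals
  _⊑_ : Term → Term → Set
  a ⊑ b = ∀ x → x ∈⟨ a ⟩ → x ∈⟨ b ⟩

  _≋_ : Term → Term → Set
  a ≋ b = (a ⊑ b) × (b ⊑ a)

  -- join in Id_c G:  ⟨a⟩ ∨ ⟨b⟩ = ⟨|a| + |b|⟩
  _⊔ᵢ_ : Term → Term → Term
  a ⊔ᵢ b = ∣ a ∣ ⊕ ∣ b ∣

  Archimedean : Set
  Archimedean = ∀ a b → (∀ n → (nℚ n · a) ≤G b) → a ≤G 𝟘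

  HasStrongUnit : Set
  HasStrongUnit = ∃[ e ] ((𝟘 ≤G e) × (∀ x → x ∈⟨ e ⟩))

  -- A binary operation on Id_c G, presented on generators: a map on terms
  -- that is well defined on principal ideals.
  record Deviation : Set where
    field
      _∖_      : Term → Term → Term
      welldef  : ∀ x x' y y' → x ≋ x' → y ≋ y' → (x ∖ y) ≋ (x' ∖ y')
      cover    : ∀ x y → x ⊑ (y ⊔ᵢ (x ∖ y))
      -- (x ∖ y) ∧ (y ∖ x) = 0 : the intersection of the ideals is {0}
      disjoint : ∀ x y g → g ∈⟨ x ∖ y ⟩ → g ∈⟨ y ∖ x ⟩ → g ≈G 𝟘

  LeftIsotone : Deviation → Set
  LeftIsotone D = ∀ x x' y → x ⊑ x' → (x ∖ y) ⊑ (x' ∖ y)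
    where open Deviation D

  RightAntitone : Deviation → Set
  RightAntitone D = ∀ x y y' → y ⊑ y' → (x ∖ y') ⊑ (x ∖ y)
    where open Deviation D

-- For 0 ≺ β put a β = ⟨p_0⟩ ∖ ⟨p_β⟩ and b β = ⟨p_β⟩ ∖ ⟨p_0⟩.  On the points with
-- u_0 = 2^-V, u_γ = 0 for 0 ≺ γ ≺ β and u_γ = 2^-i for γ ≽ β, the covering and disjointness
-- axioms make a β vanish and b β not vanish at i = 0, and the reverse at i = K, for suitable
-- V and K.  So both a β and b β switch between some consecutive scales 2^-j and 2^-(j+1).
-- An uncountability argument gives α ≺ β with the same V and j such that all variables of the
-- term at α lie below β and no variable of the term at β lies in [α, β).  The point with
-- u_γ = 0 on (0, α), 2^-j on [α, β) and 2^-(j+1) from β on, which the factor 2 in Ω allows,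
-- then looks to the term at α like scale j and to the term at β like scale j + 1.

module Submission where

open import Defs
open import Level using (0ℓ)
open import Axiom.ExcludedMiddle using (ExcludedMiddle)
open import Data.Product using (_×_; ∃-syntax; Σ-syntax; _,_; proj₁; proj₂)
open import Relation.Nullary using (¬_; yes; no; contradiction)
open import Relation.Nullary.Decidable using (does; ¬?)
open import Relation.Unary using (Pred; Decidable)
open import Data.Bool using (if_then_else_)
open import Data.Integer.Base as ℤ using (ℤ)
import Data.Integer.Properties as ℤ
open import Data.List.Base using (List; []; _∷_; _++_; filter)
open import Data.List.Membership.Propositional.Properties using (∈-filter⁺)
open import Data.List.Relation.Unary.All as All using (All; []; _∷_)
open import Data.List.Relation.Unary.All.Properties using (all-filter; ++⁻ˡ; ++⁻ʳ)
import Data.List.Extrema as Extrema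
open import Data.Nat.Base as ℕ using (ℕ; suc)
import Data.Nat.Properties as ℕ
open import Data.Rational
  using (ℚ; mkℚ; 0ℚ; 1ℚ; ½; _≤_; _<_; _+_; _*_; -_; _⊔_; _⊓_; _/_; 1/_; NonNegative; Positive;
         positive; toℚᵘ)
  renaming (∣_∣ to abs)
open import Data.Rational.Properties hiding (_≟_; _<?_)
import Data.Rational.Properties as ℚ
import Data.Rational.Unnormalised.Base as ℚᵘ
import Data.Rational.Unnormalised.Properties as ℚᵘ
open import Algebra.Properties.Group +-0-group using () renaming (⁻¹-involutive to neg-involutive)
open import Data.Sum using (inj₁; inj₂)
open import Data.Unit.Base using (tt)
open import Function.Base using (_∘_; id)
open import Induction.WellFounded using (Acc; acc)
open import Relation.Binary.Bundles using (DecTotalOrder)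
open import Relation.Binary.Definitions using (tri<; tri≈; tri>)
import Relation.Binary.Properties.StrictTotalOrder as StrictTotalOrderProperties
open import Relation.Binary.PropositionalEquality
  using (_≡_; _≢_; refl; sym; trans; cong; cong₂; subst; subst₂; module ≡-Reasoning)
open import Relation.Binary.Structures using (IsStrictTotalOrder)

-- Pairing of natural numbers and discrete search

pair : ℕ → ℕ → ℕ
pair 0    b = suc (2 ℕ.* b)
pair (suc a) b = 2 ℕ.* pair a b

-- `pair a b` is `2^a * (2b + 1)`: parity separates exponent zero from the others, and cancelling 2
-- gives the induction.
pair-injective : ∀ a c {b d} → pair a b ≡ pair c d → a ≡ c × b ≡ d
pair-injective 0    0    {b} {d} eq = refl , ℕ.*-cancelˡ-≡ b d 2 (ℕ.suc-injective eq)
pair-injective 0    (suc c) {b} {d} eq = contradiction (sym eq) (ℕ.even≢odd (pair c d) b)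
pair-injective (suc a) 0    {b} {d} eq = contradiction eq (ℕ.even≢odd (pair a b) d)
pair-injective (suc a) (suc c) eq with pair-injective a c (ℕ.*-cancelˡ-≡ _ _ 2 eq)
... | refl , b≡d = refl , b≡d

-- The search descends from `K` and stops at the first failure of `P`, which it meets at 0 at the
-- latest.
switch : ∀ {ℓ} {P : Pred ℕ ℓ} → Decidable P → ∀ K → ¬ P 0 → P K → ∃[ j ] (¬ P j × P (suc j))
switch P? 0    ¬P0 PK = contradiction PK ¬P0
switch P? (suc K) ¬P0 PK with P? K
... | yes PK′ = switch P? K ¬P0 PK′
... | no ¬PK  = K , ¬PK , PK

-- Rational arithmetic

natℚ : ℕ → ℚ
natℚ n = ℤ.+ n / 1

natℚ-+ : ∀ m n → natℚ (m ℕ.+ n) ≡ natℚ m + natℚ n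
natℚ-+ m n = toℚᵘ-injective (begin
  toℚᵘ (natℚ (m ℕ.+ n))                      ≈⟨ toℚᵘ-fromℚᵘ (fraction (m ℕ.+ n)) ⟩
  fraction (m ℕ.+ n)                         ≈⟨ ℚᵘ.*≡* (cong (ℤ._* ℤ.+ 1) (cong₂ ℤ._+_ (n≡n*1 m) (n≡n*1 n))) ⟩
  fraction m ℚᵘ.+ fraction n
    ≈⟨ ℚᵘ.+-cong (toℚᵘ-fromℚᵘ (fraction m)) (toℚᵘ-fromℚᵘ (fraction n)) ⟨
  toℚᵘ (natℚ m) ℚᵘ.+ toℚᵘ (natℚ n)           ≈⟨ toℚᵘ-homo-+ (natℚ m) (natℚ n) ⟨
  toℚᵘ (natℚ m + natℚ n)                     ∎)
  where
  open ℚᵘ.≃-Reasoning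
  fraction : ℕ → ℚᵘ.ℚᵘ
  fraction n = ℚᵘ.mkℚᵘ (ℤ.+ n) 0
  n≡n*1 : ∀ n → ℤ.+ n ≡ ℤ.+ n ℤ.* ℤ.+ 1
  n≡n*1 n = sym (ℤ.*-identityʳ (ℤ.+ n))

natℚ-nonNeg : ∀ n → NonNegative (natℚ n)
natℚ-nonNeg n = normalize-nonNeg n 1

-- The absolute value of the numerator serves as the bound, because the denominator is at least 1.
natℚ-above : ∀ q → ∃[ n ] q ≤ natℚ n
natℚ-above q@(mkℚ i d _) = ℤ.∣ i ∣ , toℚᵘ-cancel-≤ (ℚᵘ.≤-respʳ-≃
  (ℚᵘ.≃-sym (toℚᵘ-fromℚᵘ (ℚᵘ.mkℚᵘ (ℤ.+ ℤ.∣ i ∣) 0))) (ℚᵘ.*≤* (bound i)))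
  where
  bound : ∀ i → i ℤ.* ℤ.+ 1 ℤ.≤ ℤ.+ ℤ.∣ i ∣ ℤ.* ℤ.+ suc d
  bound i = subst (i ℤ.* ℤ.+ 1 ℤ.≤_) (ℤ.pos-* ℤ.∣ i ∣ (suc d))
    (subst (ℤ._≤ ℤ.+ (ℤ.∣ i ∣ ℕ.* suc d)) (sym (ℤ.*-identityʳ i))
      (ℤ.≤-trans (i≤∣i∣ i) (ℤ.+≤+ (ℕ.m≤m*n ℤ.∣ i ∣ (suc d)))))
    where
    i≤∣i∣ : ∀ i → i ℤ.≤ ℤ.+ ℤ.∣ i ∣
    i≤∣i∣ (ℤ.+ n)      = ℤ.≤-refl
    i≤∣i∣ (ℤ.-[1+ n ]) = ℤ.-≤+

0<1 : 0ℚ < 1ℚ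
0<1 = positive⁻¹ 1ℚ

multiples-bounded⇒nonPositive : ∀ {x y} → (∀ n → natℚ n * x ≤ y) → x ≤ 0ℚ
multiples-bounded⇒nonPositive {x} {y} bounded = ≮⇒≥ λ 0<x →
  let instance _ = positive 0<x
               _ = pos⇒nonZero x
      -- For positive `x` this gives `y ≤ n * x`; the multiple `suc n` then exceeds `y` strictly.
      n , y/x≤n = natℚ-above (y * 1/ x)
      open ≤-Reasoning
  in <-irrefl refl (begin-strict
    y                        ≡⟨ *-identityʳ y ⟨
    y * 1ℚ                   ≡⟨ cong (y *_) (*-inverseˡ x) ⟨
    y * (1/ x * x)           ≡⟨ *-assoc y (1/ x) x ⟨
    y * 1/ x * x             ≤⟨ *-monoʳ-≤-nonNeg x {{pos⇒nonNeg x}} y/x≤n ⟩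
    natℚ n * x               ≡⟨ cong (_* x) (+-identityˡ (natℚ n)) ⟨
    (0ℚ + natℚ n) * x        <⟨ *-monoˡ-<-pos x (+-monoˡ-< (natℚ n) 0<1) ⟩
    (1ℚ + natℚ n) * x        ≡⟨ cong (_* x) (natℚ-+ 1 n) ⟨
    natℚ (suc n) * x         ≤⟨ bounded (suc n) ⟩
    y                        ∎)

abs-⊔-≤ : ∀ x y → abs (x ⊔ y) ≤ abs x + abs y
abs-⊔-≤ x y with ⊔-sel x y
... | inj₁ eq = subst₂ _≤_ (trans (+-identityʳ _) (cong abs (sym eq))) refl (+-monoʳ-≤ (abs x) (0≤∣p∣ y))
... | inj₂ eq = subst₂ _≤_ (trans (+-identityˡ _) (cong abs (sym eq))) refl (+-monoˡ-≤ (abs y) (0≤∣p∣ x))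

abs-⊓-≤ : ∀ x y → abs (x ⊓ y) ≤ abs x + abs y
abs-⊓-≤ x y with ⊓-sel x y
... | inj₁ eq = subst₂ _≤_ (trans (+-identityʳ _) (cong abs (sym eq))) refl (+-monoʳ-≤ (abs x) (0≤∣p∣ y))
... | inj₂ eq = subst₂ _≤_ (trans (+-identityˡ _) (cong abs (sym eq))) refl (+-monoˡ-≤ (abs y) (0≤∣p∣ x))

-1*x≡-x : ∀ x → (- 1ℚ) * x ≡ - x
-1*x≡-x x = trans (sym (neg-distribˡ-* 1ℚ x)) (cong -_ (*-identityˡ x))

x⊔-x≡abs : ∀ x → x ⊔ (- 1ℚ) * x ≡ abs x
x⊔-x≡abs x with ≤-total 0ℚ x
... | inj₁ 0≤x = begin
  x ⊔ (- 1ℚ) * x  ≡⟨ cong (x ⊔_) (-1*x≡-x x) ⟩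
  x ⊔ - x         ≡⟨ p≥q⇒p⊔q≡p (≤-trans (neg-antimono-≤ 0≤x) 0≤x) ⟩
  x               ≡⟨ 0≤p⇒∣p∣≡p 0≤x ⟨
  abs x           ∎
  where open ≡-Reasoning
... | inj₂ x≤0 = begin
  x ⊔ (- 1ℚ) * x  ≡⟨ cong (x ⊔_) (-1*x≡-x x) ⟩
  x ⊔ - x         ≡⟨ p≤q⇒p⊔q≡q (≤-trans x≤0 (neg-antimono-≤ x≤0)) ⟩
  - x             ≡⟨ 0≤p⇒∣p∣≡p (neg-antimono-≤ x≤0) ⟨
  abs (- x)       ≡⟨ ∣-p∣≡∣p∣ x ⟩
  abs x           ∎
  where open ≡-Reasoning

x≤abs : ∀ x → x ≤ abs x
x≤abs x = subst (x ≤_) (x⊔-x≡abs x) (p≤p⊔q x _)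

-abs≤x : ∀ x → - abs x ≤ x
-abs≤x x = subst₂ _≤_ (cong -_ (∣-p∣≡∣p∣ x)) (neg-involutive x) (neg-antimono-≤ (x≤abs (- x)))

⊓≡0⇒≡0 : ∀ {x y} → abs x ⊓ abs y ≡ 0ℚ → x ≢ 0ℚ → y ≡ 0ℚ
⊓≡0⇒≡0 {x} {y} eq x≢0 with ⊓-sel (abs x) (abs y)
... | inj₁ sel = contradiction (∣p∣≡0⇒p≡0 x (trans (sym sel) eq)) x≢0
... | inj₂ sel = ∣p∣≡0⇒p≡0 y (trans (sym sel) eq)

half^ : ℕ → ℚ
half^ 0    = 1ℚ
half^ (suc n) = ½ * half^ n

half^-pos : ∀ n → Positive (half^ n)
half^-pos 0    = _
half^-pos (suc n) = pos*pos⇒pos ½ (half^ n) {{half^-pos n}}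

0≤half^ : ∀ n → 0ℚ ≤ half^ n
0≤half^ n = <⇒≤ (positive⁻¹ (half^ n) {{half^-pos n}})

half^≤1 : ∀ n → half^ n ≤ 1ℚ
half^≤1 0    = ≤-refl
half^≤1 (suc n) = ≤-trans (*-monoˡ-≤-nonNeg ½ (half^≤1 n)) (≤ᵇ⇒≤ tt)

half^-+ : ∀ m n → half^ (m ℕ.+ n) ≡ half^ m * half^ n
half^-+ 0    n = sym (*-identityˡ (half^ n))
half^-+ (suc m) n = trans (cong (½ *_) (half^-+ m n)) (sym (*-assoc ½ (half^ m) (half^ n)))

double-half^ : ∀ n → (1ℚ + 1ℚ) * half^ (suc n) ≡ half^ n
double-half^ n = trans (sym (*-assoc (1ℚ + 1ℚ) ½ (half^ n))) (*-identityˡ (half^ n))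

n*half^n<1 : ∀ n → natℚ n * half^ n < 1ℚ
n*half^n<1 0    = 0<1
n*half^n<1 (suc n) = begin-strict
  natℚ (suc n) * (½ * half^ n)       ≡⟨ cong (_* (½ * half^ n)) (natℚ-+ 1 n) ⟩
  (1ℚ + natℚ n) * (½ * half^ n)      ≡⟨ *-assoc (1ℚ + natℚ n) ½ (half^ n) ⟨
  (1ℚ + natℚ n) * ½ * half^ n        ≡⟨ cong (_* half^ n) (*-comm (1ℚ + natℚ n) ½) ⟩
  ½ * (1ℚ + natℚ n) * half^ n        ≡⟨ *-assoc ½ (1ℚ + natℚ n) (half^ n) ⟩
  ½ * ((1ℚ + natℚ n) * half^ n)      ≡⟨ cong (½ *_) (*-distribʳ-+ (half^ n) 1ℚ (natℚ n)) ⟩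
  ½ * (1ℚ * half^ n + natℚ n * half^ n)
    -- The product is the average of `half^ n`, at most 1, and `natℚ n * half^ n`, below 1 by
    -- induction.
    <⟨ *-monoʳ-<-pos ½ (+-mono-≤-< (subst (_≤ 1ℚ) (sym (*-identityˡ (half^ n))) (half^≤1 n)) (n*half^n<1 n)) ⟩
  ½ * (1ℚ + 1ℚ)                      ≡⟨⟩
  1ℚ                                 ∎
  where open ≤-Reasoning

n*half^[m+n]<half^m : ∀ m n → natℚ n * half^ (m ℕ.+ n) < half^ m
n*half^[m+n]<half^m m n = begin-strict
  natℚ n * half^ (m ℕ.+ n)         ≡⟨ cong (natℚ n *_) (trans (half^-+ m n) (*-comm (half^ m) (half^ n))) ⟩
  natℚ n * (half^ n * half^ m)     ≡⟨ *-assoc (natℚ n) (half^ n) (half^ m) ⟨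
  natℚ n * half^ n * half^ m       <⟨ *-monoˡ-<-pos (half^ m) {{half^-pos m}} (n*half^n<1 n) ⟩
  1ℚ * half^ m                     ≡⟨ *-identityˡ (half^ m) ⟩
  half^ m                          ∎
  where open ≤-Reasoning

-- Uncountable combinatorics

module Combinatorics (em : ExcludedMiddle 0ℓ) (W : Omega1) where
  open Omega1 W renaming (zero to 𝟎)
  open IsStrictTotalOrder isSTO using (_≟_; _<?_; compare) renaming (trans to ≺-trans)

  private
    ≼-order : DecTotalOrder _ _ _
    ≼-order = StrictTotalOrderProperties.decTotalOrder (record { isStrictTotalOrder = isSTO })

  open DecTotalOrder ≼-order using (totalOrder) renaming (_≤_ to _≼_)
  open Extrema totalOrder using (max; argmax-all; ⊥≤max; xs≤max)

  ≼-≺-trans : ∀ {x y z} → x ≼ y → y ≺ z → x ≺ z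
  ≼-≺-trans (inj₁ x≺y) y≺z = ≺-trans x≺y y≺z
  ≼-≺-trans (inj₂ refl) y≺z = y≺z

  ≢𝟎⇒𝟎≺ : ∀ {x} → x ≢ 𝟎 → 𝟎 ≺ x
  ≢𝟎⇒𝟎≺ {x} x≢𝟎 with compare 𝟎 x
  ... | tri< 𝟎≺x _ _ = 𝟎≺x
  ... | tri≈ _ 𝟎≡x _ = contradiction (sym 𝟎≡x) x≢𝟎
  ... | tri> _ _ x≺𝟎 = contradiction x≺𝟎 (least x)

  -- With `S` listing the variables of a term, the last two fields let one point be changed at `β`
  -- unseen by the term at `α`, and on `[α, β)` unseen by the term at `β`.
  record SeparatedPair (S : I → List I) (colour : I → ℕ) : Set where
    field
      α β        : I
      0≺α        : 𝟎 ≺ α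
      α≺β        : α ≺ β
      sameColour : colour α ≡ colour β
      Sα≺β       : All (_≺ β) (S α)
      Sβ-avoids  : All (λ x → x ≺ β → x ≺ α) (S β)

  module _ (S : I → List I) (colour : I → ℕ) (¬pair : ¬ SeparatedPair S colour) where

    private
      -- The last entry of `S β` below `β`, with default `𝟎`: a regressive function on the positive
      -- ordinals, as in Fodor's pressing-down lemma.
      retreat : I → I
      retreat β = max 𝟎 (filter (_<? β) (S β))

      retreat≺ : ∀ {β} → 𝟎 ≺ β → retreat β ≺ β
      retreat≺ {β} 0≺β = argmax-all id {P = _≺ β} 0≺β (all-filter (_<? β) (S β))

      ≼retreat : ∀ β → All (λ x → x ≺ β → x ≼ retreat β) (S β)
      ≼retreat β = All.tabulate λ x∈S x≺β →
        All.lookup (xs≤max 𝟎 (filter (_<? β) (S β))) (∈-filter⁺ (_<? β) x∈S x≺β)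

      Fibre : I → ℕ → I → Set
      Fibre γ c β = 𝟎 ≺ β × retreat β ≡ γ × colour β ≡ c

      roof : I → I
      roof α = max α (S α)

      -- A member `β` beyond `roof α` would form a separated pair with `α`: all of `S α` lies below
      -- `β`, and the entries of `S β` below `β` are at most the common retreat, which is below `α`.
      -- So every fibre is bounded, hence countable.
      fibre≼roof : ∀ {γ c α β} → Fibre γ c α → Fibre γ c β → β ≼ roof α
      fibre≼roof {γ} {c} {α} {β} (0≺α , rα≡γ , cα≡c) (0≺β , rβ≡γ , cβ≡c) with compare β (roof α)
      ... | tri< β≺r _ _ = inj₁ β≺r
      ... | tri≈ _ β≡r _ = inj₂ β≡r
      ... | tri> _ _ r≺β = contradiction (record
        { 0≺α = 0≺α
        ; α≺β = ≼-≺-trans (⊥≤max α (S α)) r≺β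
        ; sameColour = trans cα≡c (sym cβ≡c)
        ; Sα≺β = All.map (λ x≼r → ≼-≺-trans x≼r r≺β) (xs≤max α (S α))
        ; Sβ-avoids = All.map (λ below x≺β → ≼-≺-trans (below x≺β)
            (subst (_≺ α) (trans rα≡γ (sym rβ≡γ)) (retreat≺ 0≺α))) (≼retreat β)
        }) ¬pair

      countInitial : ∀ η → Σ[ f ∈ (I → ℕ) ] (∀ {x y} → x ≼ η → y ≼ η → f x ≡ f y → x ≡ y)
      countInitial η = f , injective
        where
        g = proj₁ (segCountable η)
        f : I → ℕ
        -- The code 0 is reserved for `η` itself, hence the shift by `suc`.
        f x = if does (x <? η) then suc (g x) else 0
        injective : ∀ {x y} → x ≼ η → y ≼ η → f x ≡ f y → x ≡ y
        injective {x} {y} x≼η y≼η eq with x <? η | y <? η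
        ... | yes x≺η | yes y≺η = proj₂ (segCountable η) x y x≺η y≺η (ℕ.suc-injective eq)
        injective (inj₁ x≺η) _ eq | no x⊀η | no _ = contradiction x≺η x⊀η
        injective (inj₂ _) (inj₁ y≺η) eq | no _ | no y⊀η = contradiction y≺η y⊀η
        injective (inj₂ x≡η) (inj₂ y≡η) eq | no _ | no _ = trans x≡η (sym y≡η)

      countFibre : ∀ γ c → Σ[ f ∈ (I → ℕ) ] (∀ {x y} → Fibre γ c x → Fibre γ c y → f x ≡ f y → x ≡ y)
      -- Excluded middle provides a member whose roof bounds the fibre; on an empty fibre any
      -- function will do.
      countFibre γ c with em {∃[ α ] Fibre γ c α}
      ... | yes (α , Fα) = proj₁ (countInitial (roof α)) ,
              λ Fx Fy → proj₂ (countInitial (roof α)) (fibre≼roof Fα Fx) (fibre≼roof Fα Fy)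
      ... | no empty = (λ _ → 0) , λ Fx _ _ → contradiction (_ , Fx) empty

      label : I → ℕ
      label β = proj₁ (countFibre (retreat β) (colour β)) β

      label-injective : ∀ {x y} → 𝟎 ≺ x → 𝟎 ≺ y → retreat x ≡ retreat y → colour x ≡ colour y →
                        label x ≡ label y → x ≡ y
      label-injective {x} {y} 0≺x 0≺y rx≡ry cx≡cy eq =
        proj₂ (countFibre (retreat x) (colour x)) (0≺x , refl , refl) (0≺y , sym rx≡ry , sym cx≡cy)
          (trans eq (cong₂ (λ γ c → proj₁ (countFibre γ c) y) (sym rx≡ry) (sym cx≡cy)))

      -- Iterating retreat descends to 𝟎, so the labels met on the way determine β.
      code : ∀ {β} → Acc _≺_ β → ℕ
      code {β} (acc rs) with β ≟ 𝟎
      ... | yes _   = 0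
      ... | no β≢𝟎 = suc (pair (code (rs (retreat≺ (≢𝟎⇒𝟎≺ β≢𝟎)))) (pair (colour β) (label β)))

      -- Equal codes give equal retreats by induction; colour and label then single out one point of
      -- the fibre. A zero code occurs only at `𝟎`.
      code-injective : ∀ {x y} (ax : Acc _≺_ x) (ay : Acc _≺_ y) → code ax ≡ code ay → x ≡ y
      code-injective {x} {y} (acc rx) (acc ry) eq with x ≟ 𝟎 | y ≟ 𝟎
      ... | yes x≡𝟎 | yes y≡𝟎 = trans x≡𝟎 (sym y≡𝟎)
      ... | no x≢𝟎  | no y≢𝟎  with pair-injective (code (rx _)) (code (ry _)) (ℕ.suc-injective eq)
      ...   | codes , rest with pair-injective (colour x) (colour y) rest
      ...     | colours , labels = label-injective (≢𝟎⇒𝟎≺ x≢𝟎) (≢𝟎⇒𝟎≺ y≢𝟎)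
                                     (code-injective (rx _) (ry _) codes) colours labels

    countable-unless-separated : Σ[ f ∈ (I → ℕ) ] (∀ x y → f x ≡ f y → x ≡ y)
    countable-unless-separated = (λ x → code (wf x)) , λ x y → code-injective (wf x) (wf y)

  separatedPair : ∀ S colour → SeparatedPair S colour
  separatedPair S colour with em {SeparatedPair S colour}
  ... | yes found = found
  ... | no ¬found = contradiction (countable-unless-separated S colour ¬found) uncountable

-- The vector lattice and its principal ideals

module Lattice (W : Omega1) where
  open Omega1 W renaming (zero to 𝟎)
  open Construction W
  open IsStrictTotalOrder isSTO using (_≟_; _<?_) renaming (trans to ≺-trans; irrefl to ≺-irrefl)

  ⟦∣∣⟧ : ∀ t u → ⟦ ∣ t ∣ ⟧ u ≡ abs (⟦ t ⟧ u)
  ⟦∣∣⟧ t u = x⊔-x≡abs (⟦ t ⟧ u)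

  archimedean : Archimedean
  archimedean a b na≤b u = multiples-bounded⇒nonPositive (λ n → na≤b n u)

  -- Coordinates lie in `[0, 1]` and every operation preserves boundedness; this makes the constant
  -- 1 a strong unit.
  bounded : ∀ t → ∃[ B ] (∀ u → abs (⟦ t ⟧ u) ≤ B)
  bounded (p α) = 1ℚ , λ u@(_ , range , _) →
    subst (_≤ 1ℚ) (sym (0≤p⇒∣p∣≡p (proj₁ (range α)))) (proj₂ (range α))
  bounded pω₁ = 1ℚ , λ _ → ≤-refl
  bounded 𝟘 = 0ℚ , λ _ → ≤-refl
  bounded (a ⊕ b) with bounded a | bounded b
  ... | A , a≤A | B , b≤B = A + B , λ u →
    ≤-trans (∣p+q∣≤∣p∣+∣q∣ (⟦ a ⟧ u) (⟦ b ⟧ u)) (+-mono-≤ (a≤A u) (b≤B u))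
  bounded (q · a) with bounded a
  ... | A , a≤A = abs q * A , λ u →
    subst (_≤ abs q * A) (sym (∣p*q∣≡∣p∣*∣q∣ q (⟦ a ⟧ u))) (*-monoˡ-≤-nonNeg (abs q) {{∣-∣-nonNeg q}} (a≤A u))
  bounded (a ∨ b) with bounded a | bounded b
  ... | A , a≤A | B , b≤B = A + B , λ u →
    ≤-trans (abs-⊔-≤ (⟦ a ⟧ u) (⟦ b ⟧ u)) (+-mono-≤ (a≤A u) (b≤B u))
  bounded (a ∧ b) with bounded a | bounded b
  ... | A , a≤A | B , b≤B = A + B , λ u →
    ≤-trans (abs-⊓-≤ (⟦ a ⟧ u) (⟦ b ⟧ u)) (+-mono-≤ (a≤A u) (b≤B u))

  -- Together with `∈⟨⟩-elim` this trades the two-sided bound for one inequality between absolute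
  -- values.
  ∈⟨⟩-intro : ∀ {x a} n → (∀ u → abs (⟦ x ⟧ u) ≤ nℚ n * abs (⟦ a ⟧ u)) → x ∈⟨ a ⟩
  ∈⟨⟩-intro {x} {a} n dominated = n , lower , upper
    where
    upper : x ≤G (nℚ n · ∣ a ∣)
    upper u = ≤-trans (x≤abs (⟦ x ⟧ u))
      (subst (λ v → abs (⟦ x ⟧ u) ≤ nℚ n * v) (sym (⟦∣∣⟧ a u)) (dominated u))
    lower : ((- nℚ n) · ∣ a ∣) ≤G x
    lower u = begin
      (- nℚ n) * ⟦ ∣ a ∣ ⟧ u   ≡⟨ cong ((- nℚ n) *_) (⟦∣∣⟧ a u) ⟩
      (- nℚ n) * abs (⟦ a ⟧ u) ≡⟨ neg-distribˡ-* (nℚ n) _ ⟨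
      - (nℚ n * abs (⟦ a ⟧ u)) ≤⟨ neg-antimono-≤ (dominated u) ⟩
      - abs (⟦ x ⟧ u)          ≤⟨ -abs≤x (⟦ x ⟧ u) ⟩
      ⟦ x ⟧ u                  ∎
      where open ≤-Reasoning

  abs≤⇒∈⟨⟩ : ∀ {x a} → (∀ u → abs (⟦ x ⟧ u) ≤ abs (⟦ a ⟧ u)) → x ∈⟨ a ⟩
  abs≤⇒∈⟨⟩ {x} {a} le = ∈⟨⟩-intro {x} {a} 1 λ u → subst (abs (⟦ x ⟧ u) ≤_) (sym (*-identityˡ _)) (le u)

  hasStrongUnit : HasStrongUnit
  hasStrongUnit = pω₁ , (λ _ → <⇒≤ 0<1) , λ x →
    let B , x≤B = bounded x
        n , B≤n = natℚ-above B
    in ∈⟨⟩-intro {x} {pω₁} n λ u → ≤-trans (x≤B u) (subst (B ≤_) (sym (*-identityʳ (nℚ n))) B≤n)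

  ∈⟨⟩-elim : ∀ {x a} → x ∈⟨ a ⟩ → ∃[ n ] (∀ u → abs (⟦ x ⟧ u) ≤ nℚ n * abs (⟦ a ⟧ u))
  ∈⟨⟩-elim {x} {a} (n , lower , upper) = n , λ u →
    subst₂ (λ v w → v ≤ nℚ n * w) (x⊔-x≡abs (⟦ x ⟧ u)) (⟦∣∣⟧ a u) (⊔-lub (upper u) (begin
      (- 1ℚ) * ⟦ x ⟧ u              ≡⟨ -1*x≡-x (⟦ x ⟧ u) ⟩
      - ⟦ x ⟧ u                     ≤⟨ neg-antimono-≤ (lower u) ⟩
      - ((- nℚ n) * ⟦ ∣ a ∣ ⟧ u)    ≡⟨ cong -_ (neg-distribˡ-* (nℚ n) _) ⟨
      - - (nℚ n * ⟦ ∣ a ∣ ⟧ u)      ≡⟨ neg-involutive _ ⟩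
      nℚ n * ⟦ ∣ a ∣ ⟧ u            ∎))
    where open ≤-Reasoning

  a∈⟨a⟩ : ∀ a → a ∈⟨ a ⟩
  a∈⟨a⟩ a = abs≤⇒∈⟨⟩ {a} {a} (λ _ → ≤-refl)

  ⊑⇒dominated : ∀ {a b} → a ⊑ b → ∃[ n ] (∀ u → abs (⟦ a ⟧ u) ≤ nℚ n * abs (⟦ b ⟧ u))
  ⊑⇒dominated {a} {b} a⊑b = ∈⟨⟩-elim {a} {b} (a⊑b a (a∈⟨a⟩ a))

  -- A multiple of `abs (⟦ b ⟧ u)` dominates `abs (⟦ a ⟧ u)`. Hence a single point where `b`
  -- vanishes and `a` does not refutes the inclusion, which is how both failures in the theorem are
  -- obtained.
  ⊑-vanishing : ∀ {a b} → a ⊑ b → ∀ u → ⟦ b ⟧ u ≡ 0ℚ → ⟦ a ⟧ u ≡ 0ℚ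
  ⊑-vanishing {a} {b} a⊑b u b≡0 = ∣p∣≡0⇒p≡0 (⟦ a ⟧ u) (≤-antisym (begin
    abs (⟦ a ⟧ u)                          ≤⟨ proj₂ (⊑⇒dominated {a} {b} a⊑b) u ⟩
    nℚ n * abs (⟦ b ⟧ u)                   ≡⟨ cong (λ v → nℚ n * abs v) b≡0 ⟩
    nℚ n * 0ℚ                              ≡⟨ *-zeroʳ (nℚ n) ⟩
    0ℚ                                     ∎)
    (0≤∣p∣ (⟦ a ⟧ u)))
    where
    open ≤-Reasoning
    n = proj₁ (⊑⇒dominated {a} {b} a⊑b)

  -- The factor 2 in the definition of `Ω` doubles the multiplier, whence `n + n`. These inclusions
  -- turn the failures at particular ordinals into failures of isotonicity and antitonicity.
  p-monotone : ∀ {α β} → 𝟎 ≺ α → α ≺ β → p α ⊑ p β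
  p-monotone {α} {β} 0≺α α≺β x x∈ with ∈⟨⟩-elim {x} {p α} x∈
  ... | n , dominated = ∈⟨⟩-intro {x} {p β} (n ℕ.+ n) λ u@(v , range , slow) → begin
    abs (⟦ x ⟧ u)                ≤⟨ dominated u ⟩
    nℚ n * abs (v α)             ≡⟨ cong (nℚ n *_) (0≤p⇒∣p∣≡p (proj₁ (range α))) ⟩
    nℚ n * v α                   ≤⟨ *-monoˡ-≤-nonNeg (nℚ n) {{natℚ-nonNeg n}} (slow α β 0≺α α≺β) ⟩
    nℚ n * (two * v β)           ≡⟨ *-assoc (nℚ n) two (v β) ⟨
    nℚ n * two * v β             ≡⟨ cong (_* v β) (*-distribˡ-+ (nℚ n) 1ℚ 1ℚ) ⟩
    (nℚ n * 1ℚ + nℚ n * 1ℚ) * v β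
      ≡⟨ cong₂ _*_ (trans (natℚ-+ n n) (sym (cong₂ _+_ (*-identityʳ (nℚ n)) (*-identityʳ (nℚ n)))))
                   (0≤p⇒∣p∣≡p (proj₁ (range β))) ⟨
    nℚ (n ℕ.+ n) * abs (v β)     ∎
    where open ≤-Reasoning

  -- Finite supports of terms and step-shaped test points

  vars : Term → List I
  vars (p α)   = α ∷ []
  vars pω₁     = []
  vars 𝟘       = []
  vars (a ⊕ b) = vars a ++ vars b
  vars (_ · a) = vars a
  vars (a ∨ b) = vars a ++ vars b
  vars (a ∧ b) = vars a ++ vars b

  ⟦⟧-local : ∀ t {u w : Ω} → All (λ x → proj₁ u x ≡ proj₁ w x) (vars t) → ⟦ t ⟧ u ≡ ⟦ t ⟧ w
  ⟦⟧-local (p α)   (eq ∷ []) = eq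
  ⟦⟧-local pω₁     _  = refl
  ⟦⟧-local 𝟘       _  = refl
  ⟦⟧-local (a ⊕ b) eqs = cong₂ _+_ (⟦⟧-local a (++⁻ˡ (vars a) eqs)) (⟦⟧-local b (++⁻ʳ (vars a) eqs))
  ⟦⟧-local (q · a) eqs = cong (q *_) (⟦⟧-local a eqs)
  ⟦⟧-local (a ∨ b) eqs = cong₂ _⊔_ (⟦⟧-local a (++⁻ˡ (vars a) eqs)) (⟦⟧-local b (++⁻ʳ (vars a) eqs))
  ⟦⟧-local (a ∧ b) eqs = cong₂ _⊓_ (⟦⟧-local a (++⁻ˡ (vars a) eqs)) (⟦⟧-local b (++⁻ʳ (vars a) eqs))

  -- Equal ordinals collapse the interval `[α, β)`, so the one-scale points and the two-scale point
  -- share one proof of membership in `Ω`.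
  step : I → I → (v s t : ℚ) → I → ℚ
  step α β v s t x =
    if does (x ≟ 𝟎) then v else if does (x <? α) then 0ℚ else if does (x <? β) then s else t

  step-𝟎 : ∀ α β v s t → step α β v s t 𝟎 ≡ v
  step-𝟎 α β v s t with 𝟎 ≟ 𝟎
  ... | yes _  = refl
  ... | no 𝟎≢𝟎 = contradiction refl 𝟎≢𝟎

  step-ββ : ∀ {β} v s → 𝟎 ≺ β → step β β v s s β ≡ s
  step-ββ {β} v s 0≺β with β ≟ 𝟎 | β <? β
  ... | yes β≡𝟎 | _      = contradiction 0≺β (≺-irrefl (sym β≡𝟎))
  ... | no _    | yes β≺β = contradiction β≺β (≺-irrefl refl)
  ... | no _    | no _    = refl

  step-below : ∀ {α β} v s t {x} → x ≺ β → step α β v s t x ≡ step α α v s s x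
  step-below {α} {β} v s t {x} x≺β with x ≟ 𝟎 | x <? α | x <? β
  ... | yes _ | _     | _      = refl
  ... | no _  | yes _ | _      = refl
  ... | no _  | no _  | yes _  = refl
  ... | no _  | no _  | no x⊀β = contradiction x≺β x⊀β

  -- An index other than `𝟎` that avoids `[α, β)` lies either below `α`, where both points are 0, or
  -- at `β` or beyond, where both are `t`.
  step-avoiding : ∀ {α β} v s t {x} → α ≺ β → (x ≺ β → x ≺ α) → step α β v s t x ≡ step β β v t t x
  step-avoiding {α} {β} v s t {x} α≺β avoid with x ≟ 𝟎 | x <? α | x <? β
  ... | yes _ | _       | _       = refl
  ... | no _  | yes _   | yes _   = refl
  ... | no _  | yes x≺α | no x⊀β  = contradiction (≺-trans x≺α α≺β) x⊀β
  ... | no _  | no x⊀α  | yes x≺β = contradiction (avoid x≺β) x⊀α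
  ... | no _  | no _    | no _    = refl

  step-preserves : ∀ {ℓ} (P : ℚ → Set ℓ) α β {v s t} → P 0ℚ → P v → P s → P t → ∀ x → P (step α β v s t x)
  step-preserves P α β P0 Pv Ps Pt x with x ≟ 𝟎 | x <? α | x <? β
  ... | yes _ | _     | _     = Pv
  ... | no _  | yes _ | _     = P0
  ... | no _  | no _  | yes _ = Ps
  ... | no _  | no _  | no _  = Pt

  x≤2x : ∀ {x} → 0ℚ ≤ x → x ≤ two * x
  x≤2x {x} 0≤x = begin
    x                ≡⟨ +-identityʳ x ⟨
    x + 0ℚ           ≤⟨ +-monoʳ-≤ x 0≤x ⟩
    x + x            ≡⟨ cong₂ _+_ (*-identityˡ x) (*-identityˡ x) ⟨
    1ℚ * x + 1ℚ * x  ≡⟨ *-distribʳ-+ x 1ℚ 1ℚ ⟨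
    two * x          ∎
    where open ≤-Reasoning

  -- Along positive indices the values run through 0, `s`, `t` in this order, so only the passage
  -- from `s` to `t` calls on `s ≤ two * t`.
  step-slow : ∀ α β {v s t} → 0ℚ ≤ v → 0ℚ ≤ s → 0ℚ ≤ t → s ≤ two * t →
              ∀ γ δ → 𝟎 ≺ γ → γ ≺ δ → step α β v s t γ ≤ two * step α β v s t δ
  step-slow α β {v} {s} {t} 0≤v 0≤s 0≤t s≤2t γ δ 0≺γ γ≺δ with γ ≟ 𝟎 | γ <? α | γ <? β
  ... | yes γ≡𝟎 | _       | _       = contradiction 0≺γ (≺-irrefl (sym γ≡𝟎))
  ... | no _    | yes _   | _       = ≤-trans 0≤δ (x≤2x 0≤δ)
    where
    0≤δ : 0ℚ ≤ step α β v s t δ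
    0≤δ = step-preserves (0ℚ ≤_) α β ≤-refl 0≤v 0≤s 0≤t δ
  ... | no _    | no γ⊀α  | γ<?β with δ ≟ 𝟎 | δ <? α | δ <? β
  ...   | yes δ≡𝟎 | _       | _       = contradiction (subst (γ ≺_) δ≡𝟎 γ≺δ) (least γ)
  ...   | no _    | yes δ≺α | _       = contradiction (≺-trans γ≺δ δ≺α) γ⊀α
  step-slow α β 0≤v 0≤s 0≤t s≤2t γ δ 0≺γ γ≺δ | no _ | no _ | yes _ | no _ | no _ | yes _ = x≤2x 0≤s
  step-slow α β 0≤v 0≤s 0≤t s≤2t γ δ 0≺γ γ≺δ | no _ | no _ | yes _ | no _ | no _ | no _  = s≤2t
  step-slow α β 0≤v 0≤s 0≤t s≤2t γ δ 0≺γ γ≺δ | no _ | no _ | no γ⊀β | no _ | no _ | yes δ≺β =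
    contradiction (≺-trans γ≺δ δ≺β) γ⊀β
  step-slow α β 0≤v 0≤s 0≤t s≤2t γ δ 0≺γ γ≺δ | no _ | no _ | no _ | no _ | no _ | no _  = x≤2x 0≤t

  -- The hypothesis amounts to `j ≤ i + 1`: the value may drop at `β` by at most one factor 2.
  stepPoint : I → I → (V i j : ℕ) → half^ i ≤ two * half^ j → Ω
  stepPoint α β V i j s≤2t = step α β (half^ V) (half^ i) (half^ j) ,
    step-preserves (λ q → 0ℚ ≤ q × q ≤ 1ℚ) α β (≤-refl , <⇒≤ 0<1) (range V) (range i) (range j) ,
    step-slow α β (0≤half^ V) (0≤half^ i) (0≤half^ j) s≤2t
    where
    range : ∀ n → 0ℚ ≤ half^ n × half^ n ≤ 1ℚ
    range n = 0≤half^ n , half^≤1 n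

  scalePoint : I → (V i : ℕ) → Ω
  scalePoint β V i = stepPoint β β V i i (x≤2x (0≤half^ i))

-- Change of behaviour of a deviation between consecutive scales

module Scales (W : Omega1) (D : Construction.Deviation W) where
  open Omega1 W renaming (zero to 𝟎)
  open Construction W
  open Deviation D
  open Lattice W

  -- The element `∣ a ∣ ∧ ∣ b ∣` lies in both ideals, so it is zero, and at each point one of `a`,
  -- `b` vanishes.
  ∖-disjoint : ∀ x y u → ⟦ x ∖ y ⟧ u ≢ 0ℚ → ⟦ y ∖ x ⟧ u ≡ 0ℚ
  ∖-disjoint x y u = ⊓≡0⇒≡0 (trans (sym meet≡) (disjoint x y meet meet∈ˡ meet∈ʳ u))
    where
    a b meet : Term
    a = x ∖ y
    b = y ∖ x
    meet = ∣ a ∣ ∧ ∣ b ∣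
    meet≡ : ∀ {u} → ⟦ meet ⟧ u ≡ abs (⟦ a ⟧ u) ⊓ abs (⟦ b ⟧ u)
    meet≡ {u} = cong₂ _⊓_ (⟦∣∣⟧ a u) (⟦∣∣⟧ b u)
    abs-meet : ∀ u → abs (⟦ meet ⟧ u) ≡ abs (⟦ a ⟧ u) ⊓ abs (⟦ b ⟧ u)
    abs-meet u = trans (cong abs meet≡) (0≤p⇒∣p∣≡p (⊓-glb (0≤∣p∣ (⟦ a ⟧ u)) (0≤∣p∣ (⟦ b ⟧ u))))
    meet∈ˡ : meet ∈⟨ a ⟩
    meet∈ˡ = abs≤⇒∈⟨⟩ {meet} {a} λ u → subst (_≤ abs (⟦ a ⟧ u)) (sym (abs-meet u))
      (p⊓q≤p (abs (⟦ a ⟧ u)) (abs (⟦ b ⟧ u)))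
    meet∈ʳ : meet ∈⟨ b ⟩
    meet∈ʳ = abs≤⇒∈⟨⟩ {meet} {b} λ u → subst (_≤ abs (⟦ b ⟧ u)) (sym (abs-meet u))
      (p⊓q≤q (abs (⟦ a ⟧ u)) (abs (⟦ b ⟧ u)))

  -- Where `x ∖ y` vanishes, the generator of the join reduces to `∣ y ∣`. The multiplier is uniform
  -- in `u`, so a point where `x` exceeds that multiple of `y` forces `x ∖ y` to be nonzero.
  ∖-cover : ∀ x y → ∃[ n ] (∀ u → ⟦ x ∖ y ⟧ u ≡ 0ℚ → abs (⟦ x ⟧ u) ≤ natℚ n * abs (⟦ y ⟧ u))
  ∖-cover x y = proj₁ dominated , λ u d≡0 →
    subst (λ v → abs (⟦ x ⟧ u) ≤ nℚ (proj₁ dominated) * v) (join≡ u d≡0) (proj₂ dominated u)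
    where
    dominated = ⊑⇒dominated {x} {y ⊔ᵢ (x ∖ y)} (cover x y)
    join≡ : ∀ u → ⟦ x ∖ y ⟧ u ≡ 0ℚ → abs (⟦ y ⊔ᵢ (x ∖ y) ⟧ u) ≡ abs (⟦ y ⟧ u)
    join≡ u d≡0 = begin
      abs (⟦ ∣ y ∣ ⟧ u + ⟦ ∣ x ∖ y ∣ ⟧ u)
        ≡⟨ cong abs (cong₂ _+_ (⟦∣∣⟧ y u) (trans (⟦∣∣⟧ (x ∖ y) u) (cong abs d≡0))) ⟩
      abs (abs (⟦ y ⟧ u) + 0ℚ)              ≡⟨ cong abs (+-identityʳ (abs (⟦ y ⟧ u))) ⟩
      abs (abs (⟦ y ⟧ u))                   ≡⟨ ∣∣p∣∣≡∣p∣ (⟦ y ⟧ u) ⟩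
      abs (⟦ y ⟧ u)                         ∎
      where open ≡-Reasoning

  module _ {β : I} (0≺β : 𝟎 ≺ β) where

    private
      coverˡ = ∖-cover (p 𝟎) (p β)
      coverʳ = ∖-cover (p β) (p 𝟎)

    -- With `n` the multiplier of `coverʳ`, the choice `u_0 = 2^-n` makes `u_β = 1` exceed
    -- `n * u_0`.
    bottom : ℕ
    bottom = proj₁ coverʳ

    -- With `m` the multiplier of `coverˡ`, at this scale `m * u_β` is below `u_0 = half^ bottom`.
    depth : ℕ
    depth = bottom ℕ.+ proj₁ coverˡ

    private
      at : ℕ → Ω
      at = scalePoint β bottom

      abs-p𝟎 : ∀ i → abs (⟦ p 𝟎 ⟧ (at i)) ≡ half^ bottom
      abs-p𝟎 i = trans (cong abs (step-𝟎 β β _ _ _)) (0≤p⇒∣p∣≡p (0≤half^ bottom))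

      abs-pβ : ∀ i → abs (⟦ p β ⟧ (at i)) ≡ half^ i
      abs-pβ i = trans (cong abs (step-ββ _ _ 0≺β)) (0≤p⇒∣p∣≡p (0≤half^ i))

    pβ∖p𝟎≢0 : ⟦ p β ∖ p 𝟎 ⟧ (at 0) ≢ 0ℚ
    pβ∖p𝟎≢0 d≡0 = <-irrefl refl (<-≤-trans (n*half^n<1 bottom)
      (subst₂ (λ v w → v ≤ natℚ bottom * w) (abs-pβ 0) (abs-p𝟎 0) (proj₂ coverʳ (at 0) d≡0)))

    p𝟎∖pβ≢0 : ⟦ p 𝟎 ∖ p β ⟧ (at depth) ≢ 0ℚ
    p𝟎∖pβ≢0 d≡0 = <-irrefl refl (<-≤-trans (n*half^[m+n]<half^m bottom (proj₁ coverˡ))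
      (subst₂ (λ v w → v ≤ natℚ (proj₁ coverˡ) * w) (abs-p𝟎 depth) (abs-pβ depth) (proj₂ coverˡ (at depth) d≡0)))

    p𝟎∖pβ-switch : ∃[ V ] ∃[ j ] (¬ (⟦ p 𝟎 ∖ p β ⟧ (scalePoint β V j) ≢ 0ℚ) ×
                                  ⟦ p 𝟎 ∖ p β ⟧ (scalePoint β V (suc j)) ≢ 0ℚ)
    p𝟎∖pβ-switch = bottom , switch (λ i → ¬? (⟦ p 𝟎 ∖ p β ⟧ (at i) ℚ.≟ 0ℚ)) depth
      -- At scale 0 the opposite difference is nonzero, so this one vanishes.
      (λ ≢0 → ≢0 (∖-disjoint (p β) (p 𝟎) (at 0) pβ∖p𝟎≢0)) p𝟎∖pβ≢0

    pβ∖p𝟎-switch : ∃[ V ] ∃[ j ] (⟦ p β ∖ p 𝟎 ⟧ (scalePoint β V j) ≢ 0ℚ ×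
                                  ⟦ p β ∖ p 𝟎 ⟧ (scalePoint β V (suc j)) ≡ 0ℚ)
    pβ∖p𝟎-switch = bottom , switch (λ i → ⟦ p β ∖ p 𝟎 ⟧ (at i) ℚ.≟ 0ℚ) depth
      pβ∖p𝟎≢0 (∖-disjoint (p 𝟎) (p β) (at depth) p𝟎∖pβ≢0)

-- Splicing two scales into one point

module Switching (em : ExcludedMiddle 0ℓ) (W : Omega1) where
  open Omega1 W renaming (zero to 𝟎)
  open Construction W
  open Lattice W
  open Combinatorics em W
  open IsStrictTotalOrder isSTO using (_≟_) renaming (trans to ≺-trans; irrefl to ≺-irrefl)

  -- `P` is `_≢ 0ℚ` for the terms `p 𝟎 ∖ p β` and `_≡ 0ℚ` for `p β ∖ p 𝟎`, so one argument serves
  -- both halves.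
  SwitchesAt : (I → Term) → (ℚ → Set) → I → (V j : ℕ) → Set
  SwitchesAt t P β V j = ¬ P (⟦ t β ⟧ (scalePoint β V j)) × P (⟦ t β ⟧ (scalePoint β V (suc j)))

  SwitchingPair : (I → Term) → (ℚ → Set) → Set
  SwitchingPair t P = ∃[ α ] ∃[ β ] (𝟎 ≺ α × α ≺ β × ∃[ u ] (¬ P (⟦ t α ⟧ u) × P (⟦ t β ⟧ u)))

  splice : ∀ (t : I → Term) (P : ℚ → Set) (V j : I → ℕ) → (∀ {β} → 𝟎 ≺ β → SwitchesAt t P β (V β) (j β)) →
           SeparatedPair (vars ∘ t) (λ β → pair (V β) (j β)) → SwitchingPair t P
  splice t P V j switches separated = α , β , 0≺α , α≺β , u ,
    subst (¬_ ∘ P) (sym α-sees) (proj₁ (switches 0≺α)) ,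
    subst P (sym β-sees) (proj₂ (switches (≺-trans 0≺α α≺β)))
    where
    open SeparatedPair separated

    sameScales : V α ≡ V β × j α ≡ j β
    sameScales = pair-injective (V α) (V β) sameColour

    u : Ω
    -- By `double-half^` the bound of `Ω` is attained here: `s` is exactly twice `t`.
    u = stepPoint α β (V α) (j α) (suc (j α)) (≤-reflexive (sym (double-half^ (j α))))

    α-sees : ⟦ t α ⟧ u ≡ ⟦ t α ⟧ (scalePoint α (V α) (j α))
    α-sees = ⟦⟧-local (t α) (All.map (step-below _ _ _) Sα≺β)

    β-sees : ⟦ t β ⟧ u ≡ ⟦ t β ⟧ (scalePoint β (V β) (suc (j β)))
    β-sees = trans (⟦⟧-local (t β) (All.map (step-avoiding _ _ _ α≺β) Sβ-avoids))
                   -- The point was built from the scales of `α`; the equal colours identify them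
                   -- with those of `β`.
                   (cong₂ (λ V j → ⟦ t β ⟧ (scalePoint β V (suc j))) (proj₁ sameScales) (proj₂ sameScales))

  switchingPair : ∀ (t : I → Term) (P : ℚ → Set) →
                  (∀ {β} → 𝟎 ≺ β → ∃[ V ] ∃[ j ] SwitchesAt t P β V j) → SwitchingPair t P
  switchingPair t P switches =
    splice t P (proj₁ ∘ scales) (λ β → proj₁ (proj₂ (scales β))) (λ {β} → proj₂ (proj₂ (scales β)))
      (separatedPair _ _)
    where
    scales : ∀ β → ∃[ V ] ∃[ j ] (𝟎 ≺ β → SwitchesAt t P β V j)
    scales β with β ≟ 𝟎
    -- The colouring must be total; the scales at `𝟎` are dummies, since a separated pair lies above
    -- `𝟎`.
    ... | yes β≡𝟎 = 0 , 0 , λ 0≺β → contradiction 0≺β (≺-irrefl (sym β≡𝟎))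
    ... | no β≢𝟎 = let V , j , switched = switches (≢𝟎⇒𝟎≺ β≢𝟎) in V , j , λ _ → switched

-- Failure of antitonicity and isotonicity

module Deviations (em : ExcludedMiddle 0ℓ) (W : Omega1) (D : Construction.Deviation W) where
  open Omega1 W renaming (zero to 𝟎)
  open Construction W
  open Deviation D
  open Lattice W
  open Scales W D
  open Switching em W

  not-right-antitone-at-p𝟎 : ∃[ α ] ∃[ β ] (𝟎 ≺ α × α ≺ β × ¬ ((p 𝟎 ∖ p β) ⊑ (p 𝟎 ∖ p α)))
  not-right-antitone-at-p𝟎 =
    let α , β , 0≺α , α≺β , u , ¬≢0 , ≢0 = switchingPair (λ β → p 𝟎 ∖ p β) (_≢ 0ℚ) p𝟎∖pβ-switch
    in α , β , 0≺α , α≺β , λ le →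
       -- Vanishing at `α` is known only in doubly negated form, which suffices for deriving a
       -- contradiction.
       ¬≢0 (λ ≡0 → ≢0 (⊑-vanishing {p 𝟎 ∖ p β} {p 𝟎 ∖ p α} le u ≡0))

  not-left-isotone-at-p𝟎 : ∃[ α ] ∃[ β ] (𝟎 ≺ α × α ≺ β × ¬ ((p α ∖ p 𝟎) ⊑ (p β ∖ p 𝟎)))
  not-left-isotone-at-p𝟎 =
    let α , β , 0≺α , α≺β , u , ≢0 , ≡0 = switchingPair (λ β → p β ∖ p 𝟎) (_≡ 0ℚ) pβ∖p𝟎-switch
    in α , β , 0≺α , α≺β , λ le → ≢0 (⊑-vanishing {p α ∖ p 𝟎} {p β ∖ p 𝟎} le u ≡0)

theorem6p8 : ExcludedMiddle 0ℓ → (W : Omega1) →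
  let open Omega1 W
      open Construction W
  in (Archimedean × HasStrongUnit) ×
     (∀ (D : Deviation) → ¬ LeftIsotone D × ¬ RightAntitone D) ×
     (∀ (D : Deviation) → let open Deviation D in
        ∃[ α ] ∃[ β ] ∃[ α' ] ∃[ β' ]
          ((zero ≺ α) × (α ≺ β) × (zero ≺ α') × (α' ≺ β') ×
           ¬ ((p zero ∖ p β) ⊑ (p zero ∖ p α)) ×
           ¬ ((p α' ∖ p zero) ⊑ (p β' ∖ p zero))))
theorem6p8 em W =
  (archimedean , hasStrongUnit) ,
  (λ D → let open Deviations em W D in
    (λ isotone → let α , β , 0≺α , α≺β , ⋢ = not-left-isotone-at-p𝟎 in
       ⋢ (isotone (p α) (p β) (p 𝟎) (p-monotone 0≺α α≺β))) ,
    (λ antitone → let α , β , 0≺α , α≺β , ⋢ = not-right-antitone-at-p𝟎 in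
       ⋢ (antitone (p 𝟎) (p α) (p β) (p-monotone 0≺α α≺β)))) ,
  λ D → let open Deviations em W D
            α , β , 0≺α , α≺β , ⋢ = not-right-antitone-at-p𝟎
            α′ , β′ , 0≺α′ , α′≺β′ , ⋢′ = not-left-isotone-at-p𝟎
        in α , β , α′ , β′ , 0≺α , α≺β , 0≺α′ , α′≺β′ , ⋢ , ⋢′
  where
  open Omega1 W using () renaming (zero to 𝟎)
  open Construction W
  open Lattice W
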